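{- Let $\mathbf{A}$ be a nontrivial finite Boolean algebra with underlying set $A$ and let $\neg:A\to A$ be an operator satisfying, for every $x\in A$, $$\neg\neg x=x\qquad\text{and}\qquad x\vee\neg x=1.$$ Then $\neg={\sim}$, i.e. $\neg$ coincides with the Boolean complement ${\sim}$ of $\mathbf{A}$.
   Context: The operator $\neg$ is an arbitrary unary function on $A$; no monotonicity or other compatibility with the Boolean operations is assumed beyond the two displayed equations. -}

module Defs where

open import Data.Fin.Base using (Fin)
open import Data.Nat.Base using (ℕ)
open import Data.Product.Base using (∃-syntax)
open import Function.Bundles using (Inverse)
open import Level using (Level; _⊔_)
open import Relation.Binary.Bundles using (Setoid)
import Relation.Binary.PropositionalEquality.Properties as ≡

private
  variable
    a ℓ : Level

-- The bijection is one of setoids: it is elements up to _≈_ that are counted,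
-- so Carrier itself may be infinite.
Finite : Setoid a ℓ → Set (a ⊔ ℓ)
Finite S = ∃[ n ] Inverse S (≡.setoid (Fin n))

{-# OPTIONS --safe #-}
-- Since x ∨ ¬ x = ⊤ says exactly that ∼ x ≤ ¬ x, the map x ↦ ¬ (∼ x) is
-- inflationary; being a composite of two involutions it is also injective.
-- On a finite poset such a map is the identity: an orbit is an increasing chain,
-- so it becomes stationary, and injectivity carries this back to its start.
module Submission where

open import Defs
open import Level using (Level)
open import Algebra.Core using (Op₁)
open import Algebra.Definitions using (Congruent₁)
open import Algebra.Lattice.Bundles using (BooleanAlgebra)
import Algebra.Lattice.Properties.BooleanAlgebra as BooleanAlgebraProperties
open import Data.Fin.Base using (toℕ)
open import Data.Fin.Properties using (pigeonhole)
open import Data.Nat.Base using (zero; suc; _≤′_; ≤′-refl; ≤′-step)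
open import Data.Nat.GeneralisedArithmetic using (fold)
open import Data.Nat.Properties using (n<1+n; ≤⇒≤′)
open import Data.Product.Base using (_,_)
open import Function.Base using (_∘_)
open import Function.Bundles using (Injection; Inverse)
open import Function.Definitions using (Injective)
open import Function.Properties.Inverse using (Inverse⇒Injection)
open import Relation.Binary.Bundles using (Poset)
import Relation.Binary.Reasoning.Setoid as ≈-Reasoning

module _ {c ℓ₁ ℓ₂ : Level} (P : Poset c ℓ₁ ℓ₂) where
  open Poset P

  module _ {f : Op₁ Carrier} (inflationary : ∀ x → x ≤ f x) where

    -- `_≤′_` grows at its upper end, so each `≤′-step` matches one more application of `f` at the
    -- head of `fold`.
    fold-mono-≤′ : ∀ x {m n} → m ≤′ n → fold x f m ≤ fold x f n
    fold-mono-≤′ x ≤′-refl       = refl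
    fold-mono-≤′ x (≤′-step m≤n) = trans (fold-mono-≤′ x m≤n) (inflationary _)

    module _ (injective : Injective _≈_ _≈_ f) where

      -- Both sides at stage `suc n` begin with `f`; injectivity cancels it and descends to stage
      -- `n`.
      fold-fixed⇒fixed : ∀ x n → f (fold x f n) ≈ fold x f n → f x ≈ x
      fold-fixed⇒fixed x zero    eq = eq
      fold-fixed⇒fixed x (suc n) eq = fold-fixed⇒fixed x n (injective eq)

      finite⇒inflationary∧injective⇒id : Finite Eq.setoid → ∀ x → f x ≈ x
      finite⇒inflationary∧injective⇒id (n , inv) x
        -- The `suc n` iterates from stage 0 to stage `n` cannot all have distinct indices in
        -- `Fin n`.
        with i , j , i<j , eq ← pigeonhole (n<1+n n) (Inverse.to inv ∘ fold x f ∘ toℕ)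
        = fold-fixed⇒fixed x (toℕ i) (antisym
            -- `i<j` unfolds to `suc (toℕ i) ≤ toℕ j`: the iterate after stage `i` lies below stage
            -- `j`, which equals stage `i`.
            (trans (fold-mono-≤′ x (≤⇒≤′ i<j))
                   (reflexive (Eq.sym (Injection.injective (Inverse⇒Injection inv) eq))))
            (inflationary _))

theorem3p20 : ∀ {c ℓ : Level} (A : BooleanAlgebra c ℓ) →
    let open BooleanAlgebra A renaming (¬_ to ∼_) in
    Finite setoid →
    ⊥ ≉ ⊤ →
    (¬_ : Op₁ Carrier) →
    Congruent₁ _≈_ ¬_ →
    (∀ x → (¬ (¬ x)) ≈ x) →
    (∀ x → (x ∨ (¬ x)) ≈ ⊤) →
    ∀ x → (¬ x) ≈ (∼ x)
theorem3p20 A finite _ ¬_ ¬-cong ¬¬x≈x x∨¬x≈⊤ x = begin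
  ¬ x            ≈⟨ ¬-cong (∼-involutive x) ⟨
  ¬ (∼ (∼ x))    ≈⟨ finite⇒inflationary∧injective⇒id poset x≤¬∼x ¬∼-injective finite (∼ x) ⟩
  ∼ x            ∎
  where
  open BooleanAlgebra A renaming (¬_ to ∼_; ¬-cong to ∼-cong)
  open BooleanAlgebraProperties A renaming (¬-involutive to ∼-involutive)
  open Poset poset using (_≤_)
  open ≈-Reasoning setoid

  -- Here `y ≤ z` unfolds to `y ≈ y ∧ z`, so an equational chain proves it; the covering law is used
  -- at `∼ y`, and distributivity drops `y ∧ (∼ y)`.
  x≤¬∼x : ∀ y → y ≤ (¬ (∼ y))
  x≤¬∼x y = begin
    y                                ≈⟨ ∧-identityʳ y ⟨
    y ∧ ⊤                            ≈⟨ ∧-congˡ (x∨¬x≈⊤ (∼ y)) ⟨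
    y ∧ ((∼ y) ∨ (¬ (∼ y)))          ≈⟨ ∧-distribˡ-∨ y _ _ ⟩
    (y ∧ (∼ y)) ∨ (y ∧ (¬ (∼ y)))    ≈⟨ ∨-congʳ (∧-complementʳ y) ⟩
    ⊥ ∨ (y ∧ (¬ (∼ y)))              ≈⟨ ∨-identityˡ _ ⟩
    y ∧ (¬ (∼ y))                    ∎

  -- Applying `¬` and then `∼` undoes the map, since both are involutions that respect `_≈_`.
  ¬∼-injective : Injective _≈_ _≈_ (λ y → ¬ (∼ y))
  ¬∼-injective {y} {z} eq = begin
    y                    ≈⟨ ¬∼-inverse y ⟨
    ∼ (¬ (¬ (∼ y)))      ≈⟨ ∼-cong (¬-cong eq) ⟩
    ∼ (¬ (¬ (∼ z)))      ≈⟨ ¬∼-inverse z ⟩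
    z                    ∎
    where
    ¬∼-inverse : ∀ w → (∼ (¬ (¬ (∼ w)))) ≈ w
    ¬∼-inverse w = trans (∼-cong (¬¬x≈x (∼ w))) (∼-involutive w)
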